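{- Let $G$ be a tree of order $n$, let $uv\in E(G)$, and let $G'=G\setminus\{uv\}$ be the graph obtained from $G$ by removing the edge $uv$ (keeping all vertices). All degrees below are taken in $G$. Then: (i) if $\deg(u)=\deg(v)=1$, then $meg(G')=0$; (ii) if either ($\deg(u)=1$ and $\deg(v)=2$) or ($\deg(u)\geq 3$ and $\deg(v)\geq 3$), then $meg(G')=meg(G)$; (iii) if $\deg(u)=\deg(v)=2$, then $meg(G')=meg(G)+2$; (iv) if $\deg(u)=2$ and $\deg(v)\geq 3$, then $meg(G')=meg(G)+1$; (v) if $\deg(u)=1$ and $\deg(v)\geq 3$, then $meg(G')=meg(G)-1$.
   Context: Graphs are finite, undirected and simple. In a connected graph $H$, an edge $e$ is monitored by a pair of vertices $x,y$ if $e$ lies on all shortest paths between $x$ and $y$. A set $M\subseteq V(H)$ is a monitoring edge-geodetic set (MEG-set) of $H$ if every edge of $H$ is monitored by some pair of vertices of $M$; $meg(H)$ is the minimum size of a MEG-set of $H$. For a disconnected graph, a MEG-set is the union of MEG-sets of its connected components, where the MEG-set of an isolated vertex is taken to be empty; so $meg$ is the sum of the $meg$ of the components, an isolated vertex contributing $0$. -}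

module Defs where

open import Level using (0ℓ)
open import Data.Empty using (⊥-elim)
open import Data.Fin using (Fin)
open import Data.Fin.Properties using (any?; all?; injective⇒≤) renaming (_≟_ to _≟ᶠ_)
open import Data.Fin.Subset using (Subset; _∈_; _⊆_; _∩_; Empty; ∣_∣)
open import Data.Fin.Subset.Properties
  using (_∈?_; _⊆?_; nonempty?; anySubset?; x∈p∩q⁺; x∈p∩q⁻; p∩q⊆q)
open import Data.List using (List; []; _∷_; length; head; last; lookup)
open import Data.List.Relation.Binary.Infix.Heterogeneous using (Infix; here)
open import Data.List.Relation.Binary.Infix.Heterogeneous.Properties using (infix?)
open import Data.List.Relation.Binary.Prefix.Heterogeneous using ([]; _∷_)
open import Data.List.Relation.Unary.All as All using ([]; _∷_)
open import Data.List.Relation.Unary.AllPairs using (allPairs?; []; _∷_)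
open import Data.List.Relation.Unary.Linked using (Linked; linked?; [-]; _∷_)
open import Data.List.Relation.Unary.Unique.Propositional using (Unique)
open import Data.List.Membership.Propositional.Properties using (∈-lookup)
open import Data.Maybe using (just)
open import Data.Maybe.Properties using (≡-dec)
open import Data.Nat using (ℕ; zero; suc; _≤_; _<_; z≤n; s≤s)
open import Data.Nat.Properties using (≮⇒≥; _≤?_)
open import Data.Nat.Induction using (<-rec)
open import Data.Product using (∃; ∃-syntax; _×_; _,_; proj₁; proj₂)
open import Data.Sum using (_⊎_; inj₁; inj₂)
open import Data.Vec using (tabulate)
open import Data.Vec.Properties using (lookup∘tabulate; []=⇒lookup; lookup⇒[]=)
open import Function using (_∘_; _⇔_; mk⇔; Equivalence)
open import Relation.Binary using (Rel; Decidable; Symmetric; Irreflexive)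
open import Relation.Binary.PropositionalEquality using (_≡_; refl; sym; trans; cong; subst)
open import Relation.Nullary using (¬_; Dec; yes; no; does; contradiction; ¬?)
open import Relation.Nullary.Decidable using (map′; _×-dec_; _⊎-dec_; _→-dec_; dec-true)
open import Relation.Unary using (Pred) renaming (Decidable to Decidable₁)

------------------------------------------------------------------------
-- Graphs

record Graph (n : ℕ) : Set₁ where
  infix 4 _~_ _~?_
  field
    _~_      : Rel (Fin n) 0ℓ
    _~?_     : Decidable _~_
    ~-sym    : Symmetric _~_
    ~-irrefl : Irreflexive _≡_ _~_

open Graph public using () renaming (_~_ to Adj)

private variable
  n : ℕ

subsetOf : {P : Pred (Fin n) 0ℓ} → Decidable₁ P → Subset n
subsetOf P? = tabulate (does ∘ P?)

∈-subsetOf : {P : Pred (Fin n) 0ℓ} (P? : Decidable₁ P) {x : Fin n} → x ∈ subsetOf P? ⇔ P x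
∈-subsetOf {P = P} P? {x} = mk⇔ to from
  where
  to : x ∈ subsetOf P? → P x
  to x∈ with P? x | trans (sym (lookup∘tabulate (does ∘ P?) x)) ([]=⇒lookup x∈)
  ... | yes p | _ = p
  ... | no _  | ()

  from : P x → x ∈ subsetOf P?
  from p = lookup⇒[]= x _ (trans (lookup∘tabulate (does ∘ P?) x) (dec-true (P? x) p))

neighbours : Graph n → Fin n → Subset n
neighbours G x = subsetOf (Graph._~?_ G x)

deg : Graph n → Fin n → ℕ
deg G x = ∣ neighbours G x ∣

SameEdge : (u v x y : Fin n) → Set
SameEdge u v x y = (x ≡ u × y ≡ v) ⊎ (x ≡ v × y ≡ u)

sameEdge? : (u v x y : Fin n) → Dec (SameEdge u v x y)
sameEdge? u v x y = (x ≟ᶠ u ×-dec y ≟ᶠ v) ⊎-dec (x ≟ᶠ v ×-dec y ≟ᶠ u)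

removeEdge : Graph n → (u v : Fin n) → Graph n
removeEdge G u v = record
  { _~_      = λ x y → x ~ y × ¬ SameEdge u v x y
  ; _~?_     = λ x y → x ~? y ×-dec ¬? (sameEdge? u v x y)
  ; ~-sym    = λ { (x~y , ≢uv) → ~-sym x~y , λ
                   { (inj₁ (y≡u , x≡v)) → ≢uv (inj₂ (x≡v , y≡u))
                   ; (inj₂ (y≡v , x≡u)) → ≢uv (inj₁ (x≡u , y≡v)) } }
  ; ~-irrefl = λ x≡y x~y → ~-irrefl x≡y (proj₁ x~y)
  }
  where open Graph G

------------------------------------------------------------------------
-- Paths, given by the list of their vertices; [ x ] is the path from x to x.

record IsPath (G : Graph n) (x y : Fin n) (p : List (Fin n)) : Set where
  constructor mkPath
  field
    starts : head p ≡ just x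
    ends   : last p ≡ just y
    linked : Linked (Adj G) p
    unique : Unique p

IsShortestPath : Graph n → Fin n → Fin n → List (Fin n) → Set
IsShortestPath G x y p = IsPath G x y p × (∀ q → IsPath G x y q → length p ≤ length q)

EdgeOn : (a b : Fin n) → List (Fin n) → Set
EdgeOn a b p = Infix _≡_ (a ∷ b ∷ []) p ⊎ Infix _≡_ (b ∷ a ∷ []) p

Joined : Graph n → Fin n → Fin n → Set
Joined G x y = ∃[ p ] IsPath G x y p

Connected : Graph n → Set
Connected G = ∀ x y → Joined G x y

-- A cycle is a path on at least three vertices whose ends are adjacent.
Acyclic : Graph n → Set
Acyclic G = ∀ x y p → IsPath G x y p → 3 ≤ length p → ¬ Adj G y x

IsTree : Graph n → Set
IsTree {n} G = 0 < n × Connected G × Acyclic G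

------------------------------------------------------------------------
-- Decidability: a path has at most n vertices.

private
  lookup-injective : {xs : List (Fin n)} → Unique xs → ∀ {i j} → lookup xs i ≡ lookup xs j → i ≡ j
  lookup-injective (_ ∷ _) {Fin.zero} {Fin.zero} _ = refl
  lookup-injective (x∉ ∷ _) {Fin.zero} {Fin.suc j} eq = contradiction eq (All.lookup x∉ (∈-lookup j))
  lookup-injective (x∉ ∷ _) {Fin.suc i} {Fin.zero} eq = contradiction (sym eq) (All.lookup x∉ (∈-lookup i))
  lookup-injective (_ ∷ u) {Fin.suc i} {Fin.suc j} eq = cong Fin.suc (lookup-injective u eq)

  all-bounded? : ∀ k {P : Pred (List (Fin n)) 0ℓ} → Decidable₁ P →
                 Dec (∀ xs → length xs ≤ k → P xs)
  all-bounded? zero P? = map′ (λ { p [] _ → p ; p (_ ∷ _) () }) (λ f → f [] z≤n) (P? [])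
  all-bounded? (suc k) P? =
    map′ (λ { (p , f) [] _ → p ; (p , f) (x ∷ xs) (s≤s l) → f x xs l })
         (λ f → f [] z≤n , λ x xs l → f (x ∷ xs) (s≤s l))
         (P? [] ×-dec all? (λ x → all-bounded? k (λ xs → P? (x ∷ xs))))

  any-bounded? : ∀ k {P : Pred (List (Fin n)) 0ℓ} → Decidable₁ P →
                 Dec (∃[ xs ] length xs ≤ k × P xs)
  any-bounded? zero P? = map′ (λ p → [] , z≤n , p) (λ { ([] , _ , p) → p }) (P? [])
  any-bounded? (suc k) P? =
    map′ (λ { (inj₁ p) → [] , z≤n , p
            ; (inj₂ (x , xs , l , p)) → x ∷ xs , s≤s l , p })
         (λ { ([] , _ , p) → inj₁ p
            ; (x ∷ xs , s≤s l , p) → inj₂ (x , xs , l , p) })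
         (P? [] ⊎-dec any? (λ x → any-bounded? k (λ xs → P? (x ∷ xs))))

edgeOn? : (a b : Fin n) (p : List (Fin n)) → Dec (EdgeOn a b p)
edgeOn? a b p = infix? _≟ᶠ_ (a ∷ b ∷ []) p ⊎-dec infix? _≟ᶠ_ (b ∷ a ∷ []) p

module _ {n : ℕ} (G : Graph n) where
  open Graph G

  path-length : ∀ {x y p} → IsPath G x y p → length p ≤ n
  path-length pth = injective⇒≤ (lookup-injective (IsPath.unique pth))

  isPath? : ∀ x y p → Dec (IsPath G x y p)
  isPath? x y p =
    map′ (λ { (s , e , l , u) → mkPath s e l u }) (λ { (mkPath s e l u) → s , e , l , u })
      (≡-dec _≟ᶠ_ (head p) (just x) ×-dec ≡-dec _≟ᶠ_ (last p) (just y) ×-dec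
       linked? _~?_ p ×-dec allPairs? (λ a b → ¬? (a ≟ᶠ b)) p)

  allPaths? : ∀ x y {P : Pred (List (Fin n)) 0ℓ} → Decidable₁ P →
              Dec (∀ p → IsPath G x y p → P p)
  allPaths? x y P? =
    map′ (λ f p pth → f p (path-length pth) pth) (λ f p _ → f p)
      (all-bounded? n (λ p → isPath? x y p →-dec P? p))

  isShortestPath? : ∀ x y p → Dec (IsShortestPath G x y p)
  isShortestPath? x y p = isPath? x y p ×-dec allPaths? x y (λ q → length p ≤? length q)

  joined? : Decidable (Joined G)
  joined? x y =
    map′ (λ { (p , _ , pth) → p , pth }) (λ { (p , pth) → p , path-length pth , pth })
      (any-bounded? n (isPath? x y))

------------------------------------------------------------------------
-- Monitoring edge-geodetic sets

-- The edge ab is monitored by the pair x, y.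
Monitored : Graph n → (a b x y : Fin n) → Set
Monitored G a b x y = ∀ p → IsShortestPath G x y p → EdgeOn a b p

component : Graph n → Fin n → Subset n
component G c = subsetOf (joined? G c)

Isolated : Graph n → Fin n → Set
Isolated G c = ∀ x → ¬ Adj G c x

-- M is a MEG-set of the component C of G.  The monitoring pairs are taken
-- inside C, where the paths of G and those of the subgraph induced by C agree.
IsMEGSetOn : Graph n → Subset n → Subset n → Set
IsMEGSetOn G C M =
  M ⊆ C ×
  (∀ a b → a ∈ C → b ∈ C → Adj G a b →
     ∃[ x ] ∃[ y ] x ∈ M × y ∈ M × Monitored G a b x y)

-- M is the union of its traces on the components, so it is a union of MEG-sets
-- of the components exactly when each trace is a MEG-set, empty for an isolated
-- vertex.  If G is connected the only component is the whole vertex set.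
IsMEGSet : Graph n → Subset n → Set
IsMEGSet G M = ∀ c → let C = component G c in
  (Isolated G c → Empty (M ∩ C)) × IsMEGSetOn G C (M ∩ C)

IsMinimumMEGSize : Graph n → ℕ → Set
IsMinimumMEGSize G k =
  (∃[ M ] IsMEGSet G M × ∣ M ∣ ≡ k) × (∀ M → IsMEGSet G M → k ≤ ∣ M ∣)

private module Existence {n : ℕ} (G : Graph n) where
  open Graph G

  monitored? : ∀ a b x y → Dec (Monitored G a b x y)
  monitored? a b x y =
    map′ (λ f p sp → f p (proj₁ sp) sp) (λ f p _ → f p)
      (allPaths? G x y (λ p → isShortestPath? G x y p →-dec edgeOn? a b p))

  isMEGSetOn? : ∀ C M → Dec (IsMEGSetOn G C M)
  isMEGSetOn? C M =
    M ⊆? C ×-dec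
    all? λ a → all? λ b → a ∈? C →-dec (b ∈? C →-dec (a ~? b →-dec
      any? λ x → any? λ y → x ∈? M ×-dec y ∈? M ×-dec monitored? a b x y))

  isMEGSet? : ∀ M → Dec (IsMEGSet G M)
  isMEGSet? M = all? λ c → let C = component G c in
    (all? (λ x → ¬? (c ~? x)) →-dec ¬? (nonempty? (M ∩ C))) ×-dec isMEGSetOn? C (M ∩ C)

  nonisolated : Subset n
  nonisolated = subsetOf (λ x → any? (x ~?_))

  open Equivalence

  edge-monitored : ∀ {a b} → a ~ b → Monitored G a b a b
  edge-monitored {a} {b} a~b p (mkPath s e l u , min) = go p s e (min (a ∷ b ∷ []) edge)
    where
    edge : IsPath G a b (a ∷ b ∷ [])
    edge = mkPath refl refl (a~b ∷ [-]) (((λ a≡b → ~-irrefl a≡b a~b) ∷ []) ∷ [] ∷ [])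

    go : ∀ q → head q ≡ just a → last q ≡ just b → length q ≤ 2 → EdgeOn a b q
    go (_ ∷ []) refl refl _ = ⊥-elim (~-irrefl refl a~b)
    go (_ ∷ _ ∷ []) refl refl _ = inj₁ (here (refl ∷ refl ∷ []))
    go (_ ∷ _ ∷ _ ∷ _) _ _ (s≤s (s≤s ()))

  isolated-path : ∀ {c y p} → Isolated G c → IsPath G c y p → y ≡ c
  isolated-path {p = _ ∷ []} iso (mkPath refl refl _ _) = refl
  isolated-path {p = _ ∷ _ ∷ _} iso (mkPath refl _ (c~x ∷ _) _) = ⊥-elim (iso _ c~x)

  nonisolated-MEG : IsMEGSet G nonisolated
  nonisolated-MEG c =
    (λ { iso (x , x∈) → let (x∈N , x∈C) = x∈p∩q⁻ nonisolated C x∈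
                            (_ , pth)   = to (∈-subsetOf (joined? G c)) x∈C
                            (y , x~y)   = to (∈-subsetOf (λ z → any? (z ~?_))) x∈N
                        in iso y (subst (_~ y) (isolated-path iso pth) x~y) }) ,
    p∩q⊆q nonisolated C ,
    λ a b a∈C b∈C a~b → a , b ,
      x∈p∩q⁺ (from (∈-subsetOf (λ z → any? (z ~?_))) (b , a~b) , a∈C) ,
      x∈p∩q⁺ (from (∈-subsetOf (λ z → any? (z ~?_))) (a , ~-sym a~b) , b∈C) ,
      edge-monitored a~b
    where C = component G c

  smaller : ∀ k M → IsMEGSet G M → ∣ M ∣ ≡ k → ∃ (IsMinimumMEGSize G)
  smaller = <-rec _ λ k rec M meg eq →
    case-smaller k rec M meg eq (anySubset? (λ N → isMEGSet? N ×-dec suc ∣ N ∣ ≤? k))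
    where
    case-smaller : ∀ k →
      (∀ {j} → j < k → ∀ M → IsMEGSet G M → ∣ M ∣ ≡ j → ∃ (IsMinimumMEGSize G)) →
      ∀ M → IsMEGSet G M → ∣ M ∣ ≡ k →
      Dec (∃[ N ] IsMEGSet G N × ∣ N ∣ < k) → ∃ (IsMinimumMEGSize G)
    case-smaller k rec M meg eq (yes (N , megN , N<k)) = rec N<k N megN refl
    case-smaller k rec M meg eq (no ¬smaller) =
      k , (M , meg , eq) , λ N megN → ≮⇒≥ (λ N<k → ¬smaller (N , megN , N<k))

abstract
  minimumMEGSize : (G : Graph n) → ∃ (IsMinimumMEGSize G)
  minimumMEGSize G = smaller _ nonisolated nonisolated-MEG refl
    where open Existence G

meg : Graph n → ℕ
meg G = proj₁ (minimumMEGSize G)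

meg-isMinimum : (G : Graph n) → IsMinimumMEGSize G (meg G)
meg-isMinimum G = proj₂ (minimumMEGSize G)

{-# OPTIONS --safe #-}

-- In a forest the set of leaves is the only minimum MEG-set.  It is one: from an
-- edge ab walk away on each side up to a leaf; as ab is a bridge, every path between
-- the two leaves uses it.  It lies in every other one: the edge at a leaf a is only
-- on paths that have a as an end, because a is not interior to any path.  So meg
-- counts the vertices of degree 1, and removing uv changes only the degrees of u and v.

module Submission where

open import Defs
open import Data.Nat using (ℕ; zero; suc; _+_; _≤_; _<_; s≤s; z≤n)
open import Data.Nat.Properties
  using (≤-antisym; <⇒≱; ≮⇒≥; +-suc; +-identityʳ; m<m+n; +-comm; +-assoc)
  renaming (_≟_ to _≟ⁿ_)
open import Data.Nat.Induction using (<-rec)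
open import Data.Bool using (true; false)
open import Data.Empty using (⊥)
open import Data.Fin using (Fin; zero; suc)
open import Data.Fin.Properties using (any?; _≟_)
open import Data.Fin.Subset using (Subset; _∈_; _∉_; _⊆_; _∩_; _-_; Empty; ∣_∣; ⁅_⁆)
open import Data.Fin.Subset.Properties
  using (_∈?_; nonempty?; ⊆-antisym; Empty-unique; ∣⊥∣≡0; ∣⁅x⁆∣≡1; x∈⁅x⁆; x∈⁅y⁆⇒x≡y;
         x∈p∩q⁺; x∈p∩q⁻; p∩q⊆q; p⊆q⇒∣p∣≤∣q∣; p─q⊆p; p─⊥≡p; x∈p∧x≢y⇒x∈p-y)
open import Data.List using (List; []; _∷_; length; head; last)
open import Data.List.Membership.Propositional using () renaming (_∈_ to _∈ˡ_; _∉_ to _∉ˡ_)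
open import Data.List.Relation.Binary.Infix.Heterogeneous using (Infix; here; there)
open import Data.List.Relation.Binary.Prefix.Heterogeneous using ([]; _∷_)
open import Data.List.Relation.Unary.All using (All; []; _∷_)
open import Data.List.Relation.Unary.All.Properties using (¬Any⇒All¬; All¬⇒¬Any)
open import Data.List.Relation.Unary.AllPairs using ([]; _∷_)
import Data.List.Relation.Unary.Any as Any
open import Data.List.Relation.Unary.Any using (here; there)
open import Data.List.Relation.Unary.Linked as Linked using (Linked; [-]; _∷_)
open import Data.List.Relation.Unary.Unique.Propositional using (Unique)
open import Data.Maybe using (just)
open import Data.Product using (∃-syntax; _×_; _,_; proj₁; proj₂)
open import Data.Sum using (_⊎_; inj₁; inj₂; swap; [_,_]′)
open import Data.Vec using ([]; _∷_; here; there)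
open import Function using (_∘_; Equivalence; case_of_)
open import Relation.Binary.Construct.Closure.ReflexiveTransitive
  using (Star; ε; _◅_; _◅◅_; reverse) renaming (map to map-Star)
open import Relation.Binary.PropositionalEquality
  using (_≡_; _≢_; refl; sym; trans; cong; cong₂; subst)
open import Relation.Nullary using (¬_; Dec; yes; no; contradiction; ¬?)
open import Relation.Nullary.Decidable using (_×-dec_; decidable-stable)

open Equivalence using (to; from)

private variable
  n : ℕ

-- Subsets

x∉p-x : (p : Subset n) (x : Fin n) → x ∉ p - x
x∉p-x (true  ∷ p) zero    ()
x∉p-x (false ∷ p) zero    ()
x∉p-x (true  ∷ p) (suc x) (there x∈) = x∉p-x p x x∈
x∉p-x (false ∷ p) (suc x) (there x∈) = x∉p-x p x x∈

x∈p-y⇒x≢y : (p : Subset n) {x y : Fin n} → x ∈ p - y → x ≢ y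
x∈p-y⇒x≢y p x∈ refl = x∉p-x p _ x∈

x∈p⇒∣p∣≡1+∣p-x∣ : {p : Subset n} {x : Fin n} → x ∈ p → ∣ p ∣ ≡ suc ∣ p - x ∣
x∈p⇒∣p∣≡1+∣p-x∣ {p = true ∷ p}  here       = cong suc (cong ∣_∣ (sym (p─⊥≡p p)))
x∈p⇒∣p∣≡1+∣p-x∣ {p = true ∷ p}  (there x∈) = cong suc (x∈p⇒∣p∣≡1+∣p-x∣ x∈)
x∈p⇒∣p∣≡1+∣p-x∣ {p = false ∷ p} (there x∈) = x∈p⇒∣p∣≡1+∣p-x∣ x∈

x∉p⇒p-x≡p : {p : Subset n} {x : Fin n} → x ∉ p → p - x ≡ p
x∉p⇒p-x≡p {p = p} x∉p =
  ⊆-antisym (p─q⊆p p _) (λ y∈p → x∈p∧x≢y⇒x∈p-y y∈p (λ { refl → x∉p y∈p }))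

∣Empty∣≡0 : {p : Subset n} → Empty p → ∣ p ∣ ≡ 0
∣Empty∣≡0 {n} empty = trans (cong ∣_∣ (Empty-unique empty)) (∣⊥∣≡0 n)

-- Walks and paths

-- Walks may repeat vertices, so they can be concatenated and reversed freely; distinctness is
-- restored only when an actual path is wanted.
Walk : Graph n → Fin n → Fin n → Set
Walk G = Star (Adj G)

prefixUpTo : {x : Fin n} {p : List (Fin n)} → x ∈ˡ p → List (Fin n)
prefixUpTo {x = x}     (here _)   = x ∷ []
prefixUpTo {p = y ∷ _} (there x∈) = y ∷ prefixUpTo x∈

prefixUpTo-All : ∀ {P : Fin n → Set} {x p} (x∈ : x ∈ˡ p) → All P p → All P (prefixUpTo x∈)
prefixUpTo-All (here refl) (px ∷ _)  = px ∷ []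
prefixUpTo-All (there x∈)  (py ∷ ps) = py ∷ prefixUpTo-All x∈ ps

prefixUpTo-last : ∀ {x : Fin n} {p} (x∈ : x ∈ˡ p) → last (prefixUpTo x∈) ≡ just x
prefixUpTo-last (here _)             = refl
prefixUpTo-last (there (here _))     = refl
prefixUpTo-last (there x∈@(there _)) = prefixUpTo-last x∈

prefixUpTo-unique : ∀ {x : Fin n} {p} (x∈ : x ∈ˡ p) → Unique p → Unique (prefixUpTo x∈)
prefixUpTo-unique (here _)   (_ ∷ _)  = [] ∷ []
prefixUpTo-unique (there x∈) (y∉ ∷ u) = prefixUpTo-All x∈ y∉ ∷ prefixUpTo-unique x∈ u

module _ (G : Graph n) where
  open Graph G using (_~_; ~-sym)

  prefixUpTo-linked : ∀ {x p} (x∈ : x ∈ˡ p) → Linked _~_ p → Linked _~_ (prefixUpTo x∈)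
  prefixUpTo-linked (here _)             _       = [-]
  prefixUpTo-linked (there (here refl))  (r ∷ _) = r ∷ [-]
  prefixUpTo-linked (there x∈@(there _)) (r ∷ l) = r ∷ prefixUpTo-linked x∈ l

  path-from : ∀ {x y z p} → IsPath G x y p → z ∈ˡ p → Joined G z y
  path-from pth@(mkPath refl _ _ _) (here refl) = _ , pth
  path-from {p = _ ∷ _ ∷ _} (mkPath refl e (_ ∷ l) (_ ∷ u)) (there z∈) =
    path-from (mkPath refl e l u) z∈

  -- Loop erasure: if the vertex to be prepended already lies on the path built so far, everything
  -- before its occurrence is dropped.
  Walk⇒Joined : ∀ {x y} → Walk G x y → Joined G x y
  Walk⇒Joined ε = _ ∷ [] , mkPath refl refl [-] ([] ∷ [])
  Walk⇒Joined {x} (x~z ◅ w) with Walk⇒Joined w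
  ... | p , pth with Any.any? (x ≟_) p
  ...   | yes x∈p = path-from pth x∈p
  ...   | no x∉p  with p | pth
  ...     | _ ∷ _ | mkPath refl e l u = _ , mkPath refl e (x~z ∷ l) (¬Any⇒All¬ _ x∉p ∷ u)

  linked⇒Walk : ∀ {x y p} → head p ≡ just x → last p ≡ just y → Linked _~_ p → Walk G x y
  linked⇒Walk {p = _ ∷ []}    refl refl _       = ε
  linked⇒Walk {p = _ ∷ _ ∷ _} refl e    (r ∷ l) = r ◅ linked⇒Walk refl e l

  Joined⇒Walk : ∀ {x y} → Joined G x y → Walk G x y
  Joined⇒Walk (_ , mkPath s e l _) = linked⇒Walk s e l

  ∈-component : ∀ {c x} → x ∈ component G c → Walk G c x
  ∈-component = Joined⇒Walk ∘ to (∈-subsetOf (joined? G _))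

  component-∈ : ∀ {c x} → Walk G c x → x ∈ component G c
  component-∈ = from (∈-subsetOf (joined? G _)) ∘ Walk⇒Joined

  -- Each step of the list either is `ab` in one of its directions or survives in
  -- `removeEdge G a b`. This turns "every path uses `ab`" into a question of connectivity without
  -- `ab`.
  walk-across-or-avoiding : ∀ a b {x y} p → head p ≡ just x → last p ≡ just y → Linked _~_ p →
                            EdgeOn a b p ⊎ Walk (removeEdge G a b) x y
  walk-across-or-avoiding a b (_ ∷ []) refl refl _ = inj₂ ε
  walk-across-or-avoiding a b (x ∷ z ∷ p) refl e (r ∷ l)
    with sameEdge? a b x z | walk-across-or-avoiding a b (z ∷ p) refl e l
  ... | yes (inj₁ (refl , refl)) | _             = inj₁ (inj₁ (here (refl ∷ refl ∷ [])))
  ... | yes (inj₂ (refl , refl)) | _             = inj₁ (inj₂ (here (refl ∷ refl ∷ [])))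
  ... | no _                     | inj₁ (inj₁ i) = inj₁ (inj₁ (there i))
  ... | no _                     | inj₁ (inj₂ i) = inj₁ (inj₂ (there i))
  ... | no ≢ab                   | inj₂ w        = inj₂ ((r , ≢ab) ◅ w)

  -- The two neighbours are the predecessor and the successor of `z` on the path; they differ
  -- because its vertices are distinct.
  interior⇒two-neighbours : ∀ {x y z p} → IsPath G x y p → z ∈ˡ p → z ≢ x → z ≢ y →
                            ∃[ s ] ∃[ t ] s ≢ t × z ~ s × z ~ t
  interior⇒two-neighbours (mkPath refl _ _ _) (here refl) z≢x _ = contradiction refl z≢x
  interior⇒two-neighbours {p = _ ∷ _ ∷ []} (mkPath refl refl _ _) (there (here refl)) _ z≢y =
    contradiction refl z≢y
  interior⇒two-neighbours {p = _ ∷ _ ∷ _ ∷ _}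
    (mkPath refl _ (s~z ∷ z~t ∷ _) ((_ ∷ s≢t ∷ _) ∷ _)) (there (here refl)) _ _ =
    _ , _ , s≢t , ~-sym s~z , z~t
  interior⇒two-neighbours {p = _ ∷ _ ∷ _}
    (mkPath refl e (_ ∷ l) (_ ∷ u@(w∉ ∷ _))) (there (there z∈)) _ z≢y =
    interior⇒two-neighbours (mkPath refl e l u) (there z∈)
      -- The tail starts at a new vertex, which is not `z` because `z` occurs after it.
      (λ { refl → All¬⇒¬Any w∉ z∈ }) z≢y

-- Degrees and leaves

module _ (G : Graph n) where
  open Graph G using (_~_; _~?_)

  Leaf : Fin n → Set
  Leaf x = deg G x ≡ 1

  leaf? : ∀ x → Dec (Leaf x)
  leaf? x = deg G x ≟ⁿ 1

  leaves : Subset n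
  leaves = subsetOf leaf?

  ∈-leaves : ∀ {x} → x ∈ leaves → Leaf x
  ∈-leaves = to (∈-subsetOf leaf?)

  leaves-∈ : ∀ {x} → Leaf x → x ∈ leaves
  leaves-∈ = from (∈-subsetOf leaf?)

  ∈-neighbours : ∀ {x y} → y ∈ neighbours G x → x ~ y
  ∈-neighbours = to (∈-subsetOf (_ ~?_))

  neighbours-∈ : ∀ {x y} → x ~ y → y ∈ neighbours G x
  neighbours-∈ = from (∈-subsetOf (_ ~?_))

  leaf⇒neighbour : ∀ {x} → Leaf x → ∃[ y ] x ~ y
  leaf⇒neighbour {x} leaf with nonempty? (neighbours G x)
  ... | yes (y , y∈) = y , ∈-neighbours y∈
  ... | no empty     = case trans (sym leaf) (∣Empty∣≡0 empty) of λ ()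

  -- Two distinct neighbours can be deleted from the neighbourhood one after the other, which makes
  -- the degree at least 2.
  leaf⇒unique-neighbour : ∀ {x y z} → Leaf x → x ~ y → x ~ z → y ≡ z
  leaf⇒unique-neighbour {x} {y} {z} leaf x~y x~z = decidable-stable (y ≟ z) λ y≢z →
    let y∈N-z = x∈p∧x≢y⇒x∈p-y (neighbours-∈ x~y) y≢z
        deg≡  = trans (x∈p⇒∣p∣≡1+∣p-x∣ (neighbours-∈ x~z)) (cong suc (x∈p⇒∣p∣≡1+∣p-x∣ y∈N-z))
    in case trans (sym leaf) deg≡ of λ ()

  nonleaf⇒other-neighbour : ∀ {x y} → ¬ Leaf x → x ~ y → ∃[ z ] x ~ z × z ≢ y
  nonleaf⇒other-neighbour {x} {y} ¬leaf x~y with any? (λ z → (x ~? z) ×-dec ¬? (z ≟ y))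
  ... | yes other = other
  ... | no none   = contradiction leaf ¬leaf
    where
    N⊆⁅y⁆ : neighbours G x ⊆ ⁅ y ⁆
    N⊆⁅y⁆ {z} z∈ with z ≟ y
    ... | yes refl = x∈⁅x⁆ y
    ... | no z≢y   = contradiction (z , ∈-neighbours z∈ , z≢y) none

    leaf : Leaf x
    leaf = trans (cong ∣_∣ (⊆-antisym N⊆⁅y⁆
             (λ z∈ → subst (_∈ neighbours G x) (sym (x∈⁅y⁆⇒x≡y y z∈)) (neighbours-∈ x~y))))
             (∣⁅x⁆∣≡1 y)

-- Forests

infix⇒∈ : {a b : Fin n} {p : List (Fin n)} → Infix _≡_ (a ∷ b ∷ []) p → a ∈ˡ p × b ∈ˡ p
infix⇒∈ (here (refl ∷ refl ∷ _)) = here refl , there (here refl)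
infix⇒∈ (there i)                = let a∈ , b∈ = infix⇒∈ i in there a∈ , there b∈

edgeOn⇒∈ : {a b : Fin n} {p : List (Fin n)} → EdgeOn a b p → a ∈ˡ p
edgeOn⇒∈ (inj₁ i) = proj₁ (infix⇒∈ i)
edgeOn⇒∈ (inj₂ i) = proj₂ (infix⇒∈ i)

-- No path from x to y is shortest, by strong induction on its length: a shortest
-- one would pass through the leaf a, which cannot be interior to a path.
leaf-edge-unmonitored : (G : Graph n) → ∀ {a b x y} → Leaf G a → x ≢ a → y ≢ a →
                        Monitored G a b x y → ¬ Joined G x y
leaf-edge-unmonitored G {a} {b} {x} {y} leaf x≢a y≢a monitored (p , pth) =
  <-rec (λ k → ∀ p → IsPath G x y p → length p ≡ k → ⊥) step _ p pth refl
  where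
  step : ∀ k → (∀ {j} → j < k → ∀ p → IsPath G x y p → length p ≡ j → ⊥) →
         ∀ p → IsPath G x y p → length p ≡ k → ⊥
  step _ rec p pth refl =
    let shortest = pth , λ q qth → ≮⇒≥ λ q<p → rec q<p q qth refl
        _ , _ , s≢t , a~s , a~t = interior⇒two-neighbours G pth
          (edgeOn⇒∈ (monitored p shortest)) (x≢a ∘ sym) (y≢a ∘ sym)
    in s≢t (leaf⇒unique-neighbour G leaf a~s a~t)

leaves⊆MEGSet : (G : Graph n) {M : Subset n} → IsMEGSet G M → leaves G ⊆ M
leaves⊆MEGSet G {M} meg {a} a∈L with ∈-leaves G a∈L
... | leaf with leaf⇒neighbour G leaf
...   | b , a~b with proj₂ (proj₂ (meg a)) a b (component-∈ G ε) (component-∈ G (a~b ◅ ε)) a~b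
...     | x , y , x∈ , y∈ , monitored = decidable-stable (a ∈? M) λ a∉M →
  let x∈M , x∈C = x∈p∩q⁻ M (component G a) x∈
      y∈M , y∈C = x∈p∩q⁻ M (component G a) y∈
  in leaf-edge-unmonitored G leaf (λ { refl → a∉M x∈M }) (λ { refl → a∉M y∈M }) monitored
       -- `Monitored` holds vacuously for a pair that no path joins. Here `x` and `y` are both in
       -- the component of `a`, so they are joined through `a`.
       (Walk⇒Joined G (reverse (Graph.~-sym G) (∈-component G x∈C) ◅◅ ∈-component G y∈C))

module _ (G : Graph n) (acyclic : Acyclic G) where
  open Graph G using (_~_; ~-sym; ~-irrefl)

  -- Loop erasure gives a path from `a` to `b` without the edge `ab`. One vertex would make `ab` a
  -- loop, two vertices would be the removed edge itself, and three or more close up with `ab` to a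
  -- cycle.
  edge-is-bridge : ∀ {a b} → a ~ b → ¬ Walk (removeEdge G a b) a b
  edge-is-bridge {a} {b} a~b w with Walk⇒Joined (removeEdge G a b) w
  ... | _ ∷ [] , mkPath refl refl _ _ = ~-irrefl refl a~b
  ... | _ ∷ _ ∷ [] , mkPath refl refl ((_ , ≢ab) ∷ _) _ = ≢ab (inj₁ (refl , refl))
  ... | p@(_ ∷ _ ∷ _ ∷ _) , mkPath s e l u =
    acyclic a b p (mkPath s e (Linked.map proj₁ l) u) (s≤s (s≤s (s≤s z≤n))) (~-sym a~b)

  -- If `z` were on the path beyond `w`, the segment from `x` to `z` would have at least three
  -- vertices, and the edge `zx` would close it to a cycle.
  neighbour∉path : ∀ {x y w z p} → IsPath G x y (x ∷ w ∷ p) → x ~ z → z ≢ w → z ∉ˡ x ∷ w ∷ p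
  neighbour∉path pth x~z z≢w (here refl)         = ~-irrefl refl x~z
  neighbour∉path pth x~z z≢w (there (here refl)) = z≢w refl
  neighbour∉path {x} {z = z} (mkPath _ _ l u) x~z _ (there (there z∈)) =
    acyclic x z _
      (mkPath refl (prefixUpTo-last z∈p) (prefixUpTo-linked G z∈p l) (prefixUpTo-unique z∈p u))
      (s≤s (s≤s (nonempty z∈))) (~-sym x~z)
    where
    z∈p = there (there z∈)
    nonempty : ∀ {p} (z∈ : z ∈ˡ p) → 1 ≤ length (prefixUpTo z∈)
    nonempty (here _)  = s≤s z≤n
    nonempty (there _) = s≤s z≤n

  -- A path that ends with the edge ab is prolonged at its start until it reaches
  -- a leaf; k bounds the number of steps since a path has at most n vertices.
  prolong-to-leaf : ∀ k {a b x w p} → n < k + length (x ∷ w ∷ p) → IsPath G x b (x ∷ w ∷ p) →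
    a ∈ˡ x ∷ w ∷ p → b ∈ˡ x ∷ w ∷ p → Walk (removeEdge G a b) a x →
    ∃[ z ] Leaf G z × Walk (removeEdge G a b) a z
  prolong-to-leaf zero n<length pth _ _ _ = contradiction (path-length G pth) (<⇒≱ n<length)
  prolong-to-leaf (suc k) {a} {b} {x} n< pth@(mkPath s e l@(x~w ∷ _) u) a∈ b∈ walk
    with leaf? G x
  ... | yes leaf = x , leaf , walk
  ... | no ¬leaf with nonleaf⇒other-neighbour G ¬leaf x~w
  ...   | z , x~z , z≢w = prolong-to-leaf k
    (subst (n <_) (sym (+-suc k _)) n<)
    (mkPath refl e (~-sym x~z ∷ l) (¬Any⇒All¬ _ z∉ ∷ u)) (there a∈) (there b∈)
    -- The new edge `xz` is not `ab`: both `a` and `b` are on the path and `z` is not.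
    (walk ◅◅ (x~z , λ { (inj₁ (_ , refl)) → z∉ b∈ ; (inj₂ (_ , refl)) → z∉ a∈ }) ◅ ε)
    where z∉ = neighbour∉path pth x~z z≢w

  -- The path to prolong is `ab` itself, with `b` as its fixed end, so it grows on the side of `a`
  -- only. If `a` is a leaf, it is the leaf found.
  leaf-beyond : ∀ {a b} → a ~ b → ∃[ z ] Leaf G z × Walk (removeEdge G a b) a z
  leaf-beyond {a} {b} a~b = prolong-to-leaf n (m<m+n n (s≤s z≤n))
    (mkPath refl refl (a~b ∷ [-]) (((λ { refl → ~-irrefl refl a~b }) ∷ []) ∷ [] ∷ []))
    (here refl) (there (here refl)) ε

  leaves-MEG : IsMEGSet G (leaves G)
  leaves-MEG c = isolated , p∩q⊆q (leaves G) (component G c) , edges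
    where
    isolated : Isolated G c → Empty (leaves G ∩ component G c)
    -- A walk from an isolated vertex is trivial, so `x` would be `c`; but a leaf has a neighbour.
    isolated iso (x , x∈) with x∈p∩q⁻ (leaves G) (component G c) x∈
    ... | x∈L , x∈C with ∈-component G x∈C
    ...   | ε       = let y , c~y = leaf⇒neighbour G (∈-leaves G x∈L) in iso y c~y
    ...   | c~y ◅ _ = iso _ c~y

    edges : ∀ a b → a ∈ component G c → b ∈ component G c → a ~ b →
            ∃[ x ] ∃[ y ] x ∈ leaves G ∩ component G c × y ∈ leaves G ∩ component G c ×
                          Monitored G a b x y
    edges a b a∈C b∈C a~b with leaf-beyond a~b | leaf-beyond (~-sym a~b)
    ... | x , leafx , a⇝x | y , leafy , b⇝y =
      x , y , in-component a∈C leafx (map-Star proj₁ a⇝x) ,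
              in-component b∈C leafy (map-Star proj₁ b⇝y) , monitored
      where
      in-component : ∀ {d z} → d ∈ component G c → Leaf G z → Walk G d z →
                     z ∈ leaves G ∩ component G c
      in-component d∈C leaf w =
        x∈p∩q⁺ (leaves-∈ G leaf , component-∈ G (∈-component G d∈C ◅◅ w))

      b⇝y′ : Walk (removeEdge G a b) b y
      b⇝y′ = map-Star (λ (r , ≢ba) → r , ≢ba ∘ swap) b⇝y

      monitored : Monitored G a b x y
      monitored p (mkPath s e l _ , _) with walk-across-or-avoiding G a b p s e l
      ... | inj₁ on  = on
      -- Going from `a` to `x`, along the path to `y`, and back to `b` would bypass the bridge `ab`.
      ... | inj₂ x⇝y = contradiction
        (a⇝x ◅◅ x⇝y ◅◅ reverse (Graph.~-sym (removeEdge G a b)) b⇝y′) (edge-is-bridge a~b)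

  -- Only acyclicity is assumed, so that the formula also covers the disconnected graph left by
  -- removing an edge of a tree.
  meg-forest : meg G ≡ ∣ leaves G ∣
  meg-forest with meg-isMinimum G
  ... | (M , megM , ∣M∣≡meg) , minimal = ≤-antisym (minimal (leaves G) leaves-MEG)
    (subst (∣ leaves G ∣ ≤_) ∣M∣≡meg (p⊆q⇒∣p∣≤∣q∣ (leaves⊆MEGSet G megM)))

-- Removing an edge

removeEdge-acyclic : (G : Graph n) (u v : Fin n) → Acyclic G → Acyclic (removeEdge G u v)
removeEdge-acyclic G u v acyclic x y p (mkPath s e l uniq) 3≤ (y~x , _) =
  acyclic x y p (mkPath s e (Linked.map proj₁ l) uniq) 3≤ y~x

-- The contribution of a single vertex to the leaf count, as a function of its degree. Degree 0
-- gives 0, in accordance with the convention for isolated vertices.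
leafIndicator : ℕ → ℕ
leafIndicator 1 = 1
leafIndicator _ = 0

leafIndicator-nonleaf : ∀ d → d ≢ 1 → leafIndicator d ≡ 0
leafIndicator-nonleaf zero          _   = refl
leafIndicator-nonleaf 1             d≢1 = contradiction refl d≢1
leafIndicator-nonleaf (suc (suc _)) _   = refl

-- The set `p` need agree with the leaf set at `x` only, so the lemma applies first to `leaves G`
-- and then to `leaves G - u`.
count-leaf : (G : Graph n) {p : Subset n} {x : Fin n} → (Leaf G x → x ∈ p) → (x ∈ p → Leaf G x) →
             ∣ p ∣ ≡ ∣ p - x ∣ + leafIndicator (deg G x)
count-leaf G {p} {x} ∈p ∈p⇒leaf with leaf? G x
... | yes leaf = trans (x∈p⇒∣p∣≡1+∣p-x∣ (∈p leaf))
  (trans (+-comm 1 _) (cong (λ d → ∣ p - x ∣ + leafIndicator d) (sym leaf)))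
... | no ¬leaf rewrite leafIndicator-nonleaf (deg G x) ¬leaf | x∉p⇒p-x≡p (¬leaf ∘ ∈p⇒leaf) =
  sym (+-identityʳ _)

count-leaves : (G : Graph n) {u v : Fin n} → u ≢ v →
  ∣ leaves G ∣ ≡ ∣ leaves G - u - v ∣ + leafIndicator (deg G v) + leafIndicator (deg G u)
count-leaves G {u} {v} u≢v = trans
  (count-leaf G (leaves-∈ G) (∈-leaves G))
  (cong (_+ leafIndicator (deg G u))
    (count-leaf G (λ leaf → x∈p∧x≢y⇒x∈p-y (leaves-∈ G leaf) (u≢v ∘ sym))
                  (∈-leaves G ∘ p─q⊆p (leaves G) ⁅ u ⁆)))

module _ (G : Graph n) {u v : Fin n} (u~v : Adj G u v) where
  open Graph G using (_~_; ~-irrefl; ~-sym)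

  private
    G′ : Graph n
    G′ = removeEdge G u v

    u≢v : u ≢ v
    u≢v refl = ~-irrefl refl u~v

  -- Deleting `v` from the neighbourhood of `u` in `G` gives its neighbourhood in `G′`. Writing the
  -- old degree as a successor avoids truncated subtraction.
  deg-removeEdgeˡ : deg G u ≡ suc (deg G′ u)
  deg-removeEdgeˡ = trans (x∈p⇒∣p∣≡1+∣p-x∣ (neighbours-∈ G u~v)) (cong (suc ∘ ∣_∣) (⊆-antisym
    (λ y∈ → neighbours-∈ G′ (∈-neighbours G (p─q⊆p _ _ y∈) ,
      λ { (inj₁ (_ , y≡v)) → x∈p-y⇒x≢y (neighbours G u) y∈ y≡v ; (inj₂ (u≡v , _)) → u≢v u≡v }))
    (λ y∈ → let u~y , ≢uv = ∈-neighbours G′ y∈ in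
      x∈p∧x≢y⇒x∈p-y (neighbours-∈ G u~y) (λ y≡v → ≢uv (inj₁ (refl , y≡v))))))

  deg-removeEdgeʳ : deg G v ≡ suc (deg G′ v)
  deg-removeEdgeʳ = trans (x∈p⇒∣p∣≡1+∣p-x∣ (neighbours-∈ G (~-sym u~v))) (cong (suc ∘ ∣_∣) (⊆-antisym
    (λ y∈ → neighbours-∈ G′ (∈-neighbours G (p─q⊆p _ _ y∈) ,
      λ { (inj₂ (_ , y≡u)) → x∈p-y⇒x≢y (neighbours G v) y∈ y≡u ; (inj₁ (v≡u , _)) → u≢v (sym v≡u) }))
    (λ y∈ → let v~y , ≢uv = ∈-neighbours G′ y∈ in
      x∈p∧x≢y⇒x∈p-y (neighbours-∈ G v~y) (λ y≡u → ≢uv (inj₂ (refl , y≡u))))))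

  deg-removeEdge-other : ∀ {x} → x ≢ u → x ≢ v → deg G′ x ≡ deg G x
  deg-removeEdge-other x≢u x≢v = cong ∣_∣ (⊆-antisym
    (neighbours-∈ G ∘ proj₁ ∘ ∈-neighbours G′)
    (λ y∈ → neighbours-∈ G′ (∈-neighbours G y∈ ,
      λ { (inj₁ (x≡u , _)) → x≢u x≡u ; (inj₂ (x≡v , _)) → x≢v x≡v })))

  other-leaves-removeEdge : leaves G′ - u - v ≡ leaves G - u - v
  other-leaves-removeEdge = ⊆-antisym
    (transfer G′ G (λ x≢u x≢v → trans (sym (deg-removeEdge-other x≢u x≢v))))
    (transfer G G′ (λ x≢u x≢v → trans (deg-removeEdge-other x≢u x≢v)))
    where
    transfer : (H K : Graph n) → (∀ {x} → x ≢ u → x ≢ v → Leaf H x → Leaf K x) →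
               leaves H - u - v ⊆ leaves K - u - v
    transfer H K leaf⇒leaf x∈ =
      let x∈-u = p─q⊆p _ _ x∈
          x≢u  = x∈p-y⇒x≢y (leaves H) x∈-u
          x≢v  = x∈p-y⇒x≢y (leaves H - u) x∈
      in x∈p∧x≢y⇒x∈p-y (x∈p∧x≢y⇒x∈p-y
           (leaves-∈ K (leaf⇒leaf x≢u x≢v (∈-leaves H (p─q⊆p _ _ x∈-u)))) x≢u) x≢v

  -- A walk from `u` can only alternate between `u` and `v`, each being the sole neighbour of the
  -- other; by connectedness these are all the vertices.
  two-leaves⇒no-others : Connected G → Leaf G u → Leaf G v → Empty (leaves G - u - v)
  two-leaves⇒no-others connected leafu leafv (x , x∈) =
    [ x∈p-y⇒x≢y (leaves G) (p─q⊆p _ _ x∈) , x∈p-y⇒x≢y (leaves G - u) x∈ ]′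
      (endpoint (inj₁ refl) (Joined⇒Walk G (connected u x)))
    where
    endpoint : ∀ {y z} → y ≡ u ⊎ y ≡ v → Walk G y z → z ≡ u ⊎ z ≡ v
    endpoint y∈uv        ε         = y∈uv
    endpoint (inj₁ refl) (u~z ◅ w) = endpoint (inj₂ (leaf⇒unique-neighbour G leafu u~z u~v)) w
    endpoint (inj₂ refl) (v~z ◅ w) =
      endpoint (inj₁ (leaf⇒unique-neighbour G leafv v~z (~-sym u~v))) w

  module _ (acyclic : Acyclic G) where
    -- Written with the degrees in `G′`, so that it shares its first term with `meg-after` and
    -- differs from it only in the arguments of the indicators.
    meg-before : meg G ≡ ∣ leaves G - u - v ∣
                         + leafIndicator (suc (deg G′ v)) + leafIndicator (suc (deg G′ u))
    meg-before = trans (meg-forest G acyclic) (trans (count-leaves G u≢v)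
      (cong₂ (λ d e → ∣ leaves G - u - v ∣ + leafIndicator d + leafIndicator e)
             deg-removeEdgeʳ deg-removeEdgeˡ))

    meg-after : meg G′ ≡ ∣ leaves G - u - v ∣ + leafIndicator (deg G′ v) + leafIndicator (deg G′ u)
    meg-after = trans (meg-forest G′ (removeEdge-acyclic G u v acyclic)) (trans (count-leaves G′ u≢v)
      (cong (λ p → ∣ p ∣ + leafIndicator (deg G′ v) + leafIndicator (deg G′ u))
            other-leaves-removeEdge))

-- Pure arithmetic: `k` counts the leaves other than `u` and `v`, and `d`, `e` are the degrees of
-- `u`, `v` after the removal. With variables for the `meg` values and degrees, the equations can be
-- matched by `refl`.
leafIndicator-cases : ∀ {m m′ du dv} k d e →
  m  ≡ k + leafIndicator (suc e) + leafIndicator (suc d) →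
  m′ ≡ k + leafIndicator e + leafIndicator d →
  du ≡ suc d → dv ≡ suc e →
  (du ≡ 1 → dv ≡ 1 → k ≡ 0) →
    (du ≡ 1 × dv ≡ 1 → m′ ≡ 0)
  × ((du ≡ 1 × dv ≡ 2) ⊎ (3 ≤ du × 3 ≤ dv) → m′ ≡ m)
  × (du ≡ 2 × dv ≡ 2 → m′ ≡ m + 2)
  × (du ≡ 2 × 3 ≤ dv → m′ ≡ m + 1)
  × (du ≡ 1 × 3 ≤ dv → m ≡ m′ + 1)
leafIndicator-cases k d e refl refl refl refl k≡0 =
  (λ { (refl , refl) → cong (λ j → j + 0 + 0) (k≡0 refl refl) }) ,
  (λ { (inj₁ (refl , refl)) → trans (+-identityʳ (k + 1)) (cong (_+ 1) (sym (+-identityʳ k)))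
     -- The patterns expose `d` and `e` as at least 2, so every indicator computes to 0 before and
     -- after the removal.
     ; (inj₂ (s≤s (s≤s (s≤s z≤n)) , s≤s (s≤s (s≤s z≤n)))) → refl }) ,
  (λ { (refl , refl) → trans (+-assoc k 1 1) (cong (_+ 2) (sym k+0+0≡k)) }) ,
  (λ { (refl , s≤s (s≤s (s≤s z≤n))) → cong (_+ 1) (sym (+-identityʳ (k + 0))) }) ,
  (λ { (refl , s≤s (s≤s (s≤s z≤n))) → cong (_+ 1) (sym (+-identityʳ (k + 0))) })
  where
  k+0+0≡k : k + 0 + 0 ≡ k
  k+0+0≡k = trans (+-identityʳ (k + 0)) (+-identityʳ k)

theorem3p1 : (n : ℕ) (G : Graph n) → IsTree G →
    (u v : Fin n) → Adj G u v →
    let G′ = removeEdge G u v in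
    (deg G u ≡ 1 × deg G v ≡ 1 → meg G′ ≡ 0)
    × ((deg G u ≡ 1 × deg G v ≡ 2) ⊎ (3 ≤ deg G u × 3 ≤ deg G v) → meg G′ ≡ meg G)
    × (deg G u ≡ 2 × deg G v ≡ 2 → meg G′ ≡ meg G + 2)
    × (deg G u ≡ 2 × 3 ≤ deg G v → meg G′ ≡ meg G + 1)
    × (deg G u ≡ 1 × 3 ≤ deg G v → meg G ≡ meg G′ + 1)
theorem3p1 n G (_ , connected , acyclic) u v u~v =
  leafIndicator-cases ∣ leaves G - u - v ∣ _ _
    (meg-before G u~v acyclic) (meg-after G u~v acyclic)
    (deg-removeEdgeˡ G u~v) (deg-removeEdgeʳ G u~v)
    (λ leafu leafv → ∣Empty∣≡0 (two-leaves⇒no-others G u~v connected leafu leafv))
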